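{- Let $G=(V,E)$ be a finite, connected, non-bipartite $d$-regular graph. Then $$\beta_{out}(G)\;\geq\;\beta(G)\;\geq\;\tfrac{1}{d}\,\beta_{out}(G).$$
   Context: For $A,B\subseteq V$, $e(A,B)$ denotes the number of ordered pairs $(a,b)\in A\times B$ with $a\sim b$ (so $e(A,A)$ is twice the number of edges inside $A$). For $S\subseteq V$, $\partial(S)$ is the set of edges with exactly one endpoint in $S$, $\partial_{out}(S)$ is the set of vertices not in $S$ having a neighbor in $S$, and $I(S)$ is the number of vertices of $S$ having a neighbor in $S$. For disjoint $L,R\subseteq V$ with $L\cup R\neq\emptyset$, define $$b(L,R)=\frac{e(L,L)+e(R,R)+|\partial(L\cup R)|}{d\,|L\cup R|},\qquad b_{out}(L,R)=\frac{I(L)+I(R)+|\partial_{out}(L\cup R)|}{|L\cup R|}.$$ The bipartiteness constant is $\beta(G)=\min_{L,R} b(L,R)$ and the outer vertex bipartiteness constant is $\beta_{out}(G)=\min_{L,R} b_{out}(L,R)$, both minima over disjoint $L,R$ with $L\cup R\ne\emptyset$. -}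

module Defs where

open import Data.Bool.Base using (Bool; true)
open import Data.Fin.Base using (Fin; zero; suc)
open import Data.Fin.Properties using (_<?_; any?)
open import Data.Fin.Subset using (Subset; inside; outside; _∈_; _∉_; _∪_; _∩_; ∣_∣; Empty; Nonempty; ⊤; ⊥)
open import Data.Fin.Subset.Properties using (_∈?_; nonempty?; ∉⊥; x∈p∩q⁻)
open import Data.Integer.Base using (+_)
open import Data.List.Base using (List; []; _∷_; _++_; map; mapMaybe; filter; length; allFin; cartesianProduct)
open import Data.List.Membership.Propositional.Properties using (∈-filter⁺; ∈-allFin)
open import Data.Maybe.Base using (Maybe; just; nothing)
open import Data.Nat.Base using (ℕ; zero; suc; NonZero; _+_; _*_)
open import Data.Nat.Properties using (m*n≢0)
open import Data.Product.Base using (Σ-syntax; ∃-syntax; _×_; _,_; proj₁; proj₂)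
open import Data.Rational.Base using (ℚ; _/_)
open import Data.Rational.Properties using (≤-decTotalOrder)
open import Data.Sum.Base using (_⊎_)
import Data.Vec.Base as Vec
open import Relation.Binary.Bundles using (module DecTotalOrder)
open import Data.List.Extrema (DecTotalOrder.totalOrder ≤-decTotalOrder) using (min)
open import Level using (0ℓ)
open import Relation.Binary.Core using (Rel)
open import Relation.Binary.Definitions using (Decidable; Irreflexive; Symmetric)
open import Relation.Binary.Construct.Closure.ReflexiveTransitive using (Star)
open import Relation.Binary.PropositionalEquality using (_≡_; _≢_)
open import Relation.Nullary using (¬_; yes; no; ¬?; _×-dec_; _⊎-dec_; contradiction)
import Relation.Unary as U

record Graph (n : ℕ) : Set₁ where
  infix 4 _~_ _~?_
  field
    _~_      : Rel (Fin n) 0ℓ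
    _~?_     : Decidable _~_
    ~-irrefl : Irreflexive _≡_ _~_
    ~-sym    : Symmetric _~_

module _ {n : ℕ} (G : Graph n) where
  open Graph G

  degree : Fin n → ℕ
  degree v = length (filter (v ~?_) (allFin n))

  Regular : ℕ → Set
  Regular d = ∀ v → degree v ≡ d

  Connected : Set
  Connected = ∀ u v → Star _~_ u v

  Bipartite : Set
  Bipartite = Σ[ c ∈ (Fin n → Bool) ] (∀ u v → u ~ v → c u ≢ c v)

  vertexPairs : List (Fin n × Fin n)
  vertexPairs = cartesianProduct (allFin n) (allFin n)

  e : Subset n → Subset n → ℕ
  e A B = length (filter (λ (a , b) → (a ∈? A) ×-dec (b ∈? B) ×-dec (a ~? b)) vertexPairs)

  -- Each undirected edge is listed once, with its smaller endpoint first.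
  edges : List (Fin n × Fin n)
  edges = filter (λ (u , v) → (u <? v) ×-dec (u ~? v)) vertexPairs

  ExactlyOneEndpointIn : Subset n → Fin n × Fin n → Set
  ExactlyOneEndpointIn S (u , v) = (u ∈ S × v ∉ S) ⊎ (u ∉ S × v ∈ S)

  exactlyOneEndpointIn? : ∀ S → U.Decidable (ExactlyOneEndpointIn S)
  exactlyOneEndpointIn? S (u , v) =
    ((u ∈? S) ×-dec ¬? (v ∈? S)) ⊎-dec (¬? (u ∈? S) ×-dec (v ∈? S))

  ∂ : Subset n → List (Fin n × Fin n)
  ∂ S = filter (exactlyOneEndpointIn? S) edges

  HasNeighbourIn : Subset n → Fin n → Set
  HasNeighbourIn S v = ∃[ u ] (u ∈ S × v ~ u)

  hasNeighbourIn? : ∀ S → U.Decidable (HasNeighbourIn S)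
  hasNeighbourIn? S v = any? (λ u → (u ∈? S) ×-dec (v ~? u))

  ∂-out : Subset n → List (Fin n)
  ∂-out S = filter (λ v → ¬? (v ∈? S) ×-dec hasNeighbourIn? S v) (allFin n)

  I : Subset n → ℕ
  I S = length (filter (λ v → (v ∈? S) ×-dec hasNeighbourIn? S v) (allFin n))

-- The proofs are irrelevant, so a pair is determined by L and R.
record DisjointPair (n : ℕ) : Set where
  constructor disjointPair
  field
    L R       : Subset n
    .disjoint : Empty (L ∩ R)
    .nonempty : Nonempty (L ∪ R)

nonempty⇒∣p∣≢0 : ∀ {n} {p : Subset n} → Nonempty p → NonZero ∣ p ∣
nonempty⇒∣p∣≢0 {p = inside  Vec.∷ _} _ = _
nonempty⇒∣p∣≢0 {p = outside Vec.∷ _} (suc x , Vec.there x∈p) = nonempty⇒∣p∣≢0 (x , x∈p)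

module _ {n : ℕ} (G : Graph n) where

  b : (d : ℕ) .{{_ : NonZero d}} → DisjointPair n → ℚ
  b d {{d≢0}} (disjointPair L R _ ne) =
    _/_ (+ (e G L L + e G R R + length (∂ G (L ∪ R)))) (d * ∣ L ∪ R ∣)
        {{m*n≢0 d ∣ L ∪ R ∣ {{d≢0}} {{nonempty⇒∣p∣≢0 ne}}}}

  b-out : DisjointPair n → ℚ
  b-out (disjointPair L R _ ne) =
    _/_ (+ (I G L + I G R + length (∂-out G (L ∪ R)))) ∣ L ∪ R ∣
        {{nonempty⇒∣p∣≢0 ne}}

subsets : ∀ n → List (Subset n)
subsets zero    = Vec.[] ∷ []
subsets (suc n) = map (inside Vec.∷_) (subsets n) ++ map (outside Vec.∷_) (subsets n)

toDisjointPair : ∀ {n} → Subset n × Subset n → Maybe (DisjointPair n)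
toDisjointPair (L , R) with nonempty? (L ∩ R) | nonempty? (L ∪ R)
... | no dis | yes ne = just (disjointPair L R dis ne)
... | _      | _      = nothing

disjointPairs : ∀ n → List (DisjointPair n)
disjointPairs n = mapMaybe toDisjointPair (cartesianProduct (subsets n) (subsets n))

wholePair : ∀ n → .{{NonZero n}} → DisjointPair n
wholePair (suc n) = disjointPair ⊤ ⊥
  (λ (_ , x∈) → ∉⊥ (proj₂ (x∈p∩q⁻ ⊤ ⊥ x∈)))
  (zero , Vec.here)

-- Data.List.Extrema.min needs a starting value; f (wholePair n) is itself one
-- of the values being minimised, so it does not change the minimum.
minimum : ∀ {n} .{{_ : NonZero n}} → (DisjointPair n → ℚ) → ℚ
minimum {n} f = min (f (wholePair n)) (map f (disjointPairs n))

module _ {n : ℕ} .{{_ : NonZero n}} (G : Graph n) where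

  β : (d : ℕ) .{{_ : NonZero d}} → ℚ
  β d = minimum (b G d)

  β-out : ℚ
  β-out = minimum (b-out G)

nonBipartite⇒n≢0 : ∀ {n} {G : Graph n} → ¬ Bipartite G → NonZero n
nonBipartite⇒n≢0 {zero}  ¬bip = contradiction ((λ ()) , λ ()) ¬bip
nonBipartite⇒n≢0 {suc _} _    = _

nonBipartite⇒d≢0 : ∀ {n d} {G : Graph n} → ¬ Bipartite G → Regular G d → NonZero d
nonBipartite⇒d≢0 {d = suc _} _ _ = _
nonBipartite⇒d≢0 {d = zero} {G} ¬bip reg = contradiction ((λ _ → true) , noEdge) ¬bip
  where
  open Graph G
  noEdge : ∀ u v → u ~ v → true ≢ true
  noEdge u v u~v _ with filter (u ~?_) (allFin _) | ∈-filter⁺ (u ~?_) (∈-allFin v) u~v | reg u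
  ... | [] | () | _

-- The number of vertices of S with a neighbour in T is at most e(S, T), and
-- regularity makes e(S, T) at most d times that number.  Taking S = T = L and
-- S = T = R compares e(L, L) with I(L) and e(R, R) with I(R); taking S = ∁ T,
-- T = L ∪ R compares |∂(T)| with |∂out(T)|.  So b ≤ b_out and b_out / d ≤ b hold
-- for each pair (L, R).

module Submission where

open import Defs
open import Data.Fin.Base as Fin using (Fin)
open import Data.Fin.Properties using (_<?_; <-cmp; <-asym)
open import Data.Fin.Subset using (Subset; _∈_; _∉_; _∪_; ∣_∣; ∁)
open import Data.Fin.Subset.Properties using (_∈?_; x∈∁p⇒x∉p; x∉p⇒x∈∁p)
open import Data.Integer.Base as ℤ using (+_)
import Data.Integer.Properties as ℤ
open import Data.List.Base using (List; []; _∷_; _++_; map; filter; length; allFin; cartesianProduct)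
open import Data.List.Membership.Propositional using () renaming (_∈_ to _∈ₗ_)
open import Data.List.Membership.Propositional.Properties
  using (∈-filter⁺; ∈-filter⁻; ∈-allFin; ∈-cartesianProduct⁺; ∈-map⁺; ∈-map⁻; ∈-++⁺ˡ; ∈-++⁺ʳ; ∈-++⁻; ∈-length)
open import Data.List.Membership.Propositional.Properties.WithK using (unique∧set⇒bag)
open import Data.List.Properties using (length-++; length-map; filter-++; filter-≐; filter-none)
open import Data.List.Relation.Binary.BagAndSetEquality using (∼bag⇒↭)
open import Data.List.Relation.Binary.Permutation.Propositional.Properties using (↭-length)
open import Data.List.Relation.Binary.Sublist.Propositional using (⊆-refl)
import Data.List.Relation.Binary.Sublist.Propositional.Properties as Sublist
open import Data.List.Relation.Unary.All as All using (All)
import Data.List.Relation.Unary.All.Properties as All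
open import Data.List.Relation.Unary.Unique.Propositional using (Unique)
import Data.List.Relation.Unary.Unique.Propositional.Properties as Unique
open import Data.Nat.Base as ℕ using (ℕ; suc; NonZero; _+_)
import Data.Nat.Properties as ℕ
open import Data.Product.Base using (_×_; _,_; proj₁; proj₂; swap)
open import Data.Rational.Base using (ℚ; _≤_; _≥_; _/_; _*_; toℚᵘ)
open import Data.Rational.Properties
  using (≤-trans; ≤-decTotalOrder; toℚᵘ-cancel-≤; toℚᵘ-mono-≤; toℚᵘ-fromℚᵘ; toℚᵘ-homo-*; *-monoˡ-≤-nonNeg; normalize-nonNeg)
import Data.Rational.Unnormalised.Base as ℚᵘ
import Data.Rational.Unnormalised.Properties as ℚᵘ
open import Data.Sum.Base using (inj₁; inj₂)
open import Function.Base using (_∘_)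
open import Function.Bundles using (mk⇔)
open import Level using (Level)
open import Relation.Binary.Bundles using (module DecTotalOrder)
open import Data.List.Extrema (DecTotalOrder.totalOrder ≤-decTotalOrder) using (v≤min⁺; min≤⊤; min≤xs)
open import Relation.Binary.Definitions using (tri<; tri≈; tri>)
open import Relation.Binary.PropositionalEquality using (_≡_; refl; sym; trans; cong; subst; subst₂; module ≡-Reasoning)
open import Relation.Nullary using (¬_; yes; no; ¬?; _×-dec_; _⊎-dec_; contradiction)
open import Relation.Unary using (Pred; Decidable)

private
  variable
    a p q : Level
    A B : Set a

-- Counting list entries and pairs by a decidable predicate.

module _ {P : Pred A p} (P? : Decidable P) where

  count : List A → ℕ
  count xs = length (filter P? xs)

  count-map : (f : B → A) (xs : List B) →
              count (map f xs) ≡ length (filter (P? ∘ f) xs)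
  count-map f []       = refl
  count-map f (x ∷ xs) with P? (f x)
  ... | yes _ = cong suc (count-map f xs)
  ... | no  _ = count-map f xs

module _ {P : Pred A p} {Q : Pred A q} (P? : Decidable P) (Q? : Decidable Q) where

  count-mono : (∀ {x} → P x → Q x) → ∀ xs → count P? xs ℕ.≤ count Q? xs
  count-mono P⊆Q xs =
    Sublist.length-mono-≤ (Sublist.filter⁺ P? Q? (λ { refl → P⊆Q }) (⊆-refl {x = xs}))

  count-⊎ : (∀ x → P x → ¬ Q x) → ∀ xs →
            count (λ x → P? x ⊎-dec Q? x) xs ≡ count P? xs + count Q? xs
  count-⊎ disj []       = refl
  count-⊎ disj (x ∷ xs) with P? x | Q? x
  ... | yes Px | yes Qx = contradiction Qx (disj x Px)
  ... | yes _  | no  _  = cong suc (count-⊎ disj xs)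
  ... | no  _  | yes _  = trans (cong suc (count-⊎ disj xs)) (sym (ℕ.+-suc _ _))
  ... | no  _  | no  _  = count-⊎ disj xs

module _ {R : Pred (A × B) p} (R? : Decidable R) where

  private
    row : A → List B → ℕ
    row x = count (λ y → R? (x , y))

  -- `cartesianProduct` lists the pairs with first component `x` before all others, so a count of
  -- pairs can be bounded row by row, by induction on the first list.
  count-cartesianProduct-∷ : ∀ x xs ys →
    count R? (cartesianProduct (x ∷ xs) ys) ≡ row x ys + count R? (cartesianProduct xs ys)
  count-cartesianProduct-∷ x xs ys = begin
    length (filter R? (map (x ,_) ys ++ rest))             ≡⟨ cong length (filter-++ R? (map (x ,_) ys) rest) ⟩
    length (filter R? (map (x ,_) ys) ++ filter R? rest)   ≡⟨ length-++ (filter R? (map (x ,_) ys)) ⟩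
    count R? (map (x ,_) ys) + count R? rest               ≡⟨ cong (_+ count R? rest) (count-map R? (x ,_) ys) ⟩
    row x ys + count R? rest                               ∎
    where
    open ≡-Reasoning
    rest = cartesianProduct xs ys

  module _ {P : Pred A q} (P? : Decidable P) (ys : List B) where

    -- Each entry satisfying `P` pays for itself with a pair from its own row.
    count≤count-cartesianProduct : (∀ x → P x → 1 ℕ.≤ row x ys) → ∀ xs →
      count P? xs ℕ.≤ count R? (cartesianProduct xs ys)
    count≤count-cartesianProduct 1≤row []       = ℕ.z≤n
    count≤count-cartesianProduct 1≤row (x ∷ xs)
      rewrite count-cartesianProduct-∷ x xs ys with P? x
    ... | yes Px = ℕ.+-mono-≤ (1≤row x Px) (count≤count-cartesianProduct 1≤row xs)
    ... | no  _  = ℕ.m≤n⇒m≤o+n _ (count≤count-cartesianProduct 1≤row xs)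

    -- The vanishing of the rows outside `P` is what makes the bound scale with the count of `P`
    -- instead of with the length of `xs`.
    count-cartesianProduct≤count* : ∀ d → (∀ x → P x → row x ys ℕ.≤ d) → (∀ x → ¬ P x → row x ys ≡ 0) →
      ∀ xs → count R? (cartesianProduct xs ys) ℕ.≤ count P? xs ℕ.* d
    count-cartesianProduct≤count* d row≤d row≡0 []       = ℕ.z≤n
    count-cartesianProduct≤count* d row≤d row≡0 (x ∷ xs)
      rewrite count-cartesianProduct-∷ x xs ys with P? x
    ... | yes Px = ℕ.+-mono-≤ (row≤d x Px) (count-cartesianProduct≤count* d row≤d row≡0 xs)
    ... | no ¬Px rewrite row≡0 x ¬Px = count-cartesianProduct≤count* d row≤d row≡0 xs

-- Arcs between vertex sets, and edge and vertex boundaries.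

module _ {n : ℕ} (G : Graph n) where
  open Graph G

  -- One predicate for both vertex counts: at `T = S` its count over `allFin n` is `I G S` by
  -- definition, and at `S = ∁ T` it is the size of the outer boundary of `T`.
  ∈-withNeighbourIn? : (S T : Subset n) → Decidable (λ v → v ∈ S × HasNeighbourIn G T v)
  ∈-withNeighbourIn? S T v = (v ∈? S) ×-dec hasNeighbourIn? G T v

  private
    arc? : (S T : Subset n) → Decidable (λ ((u , v) : Fin n × Fin n) → u ∈ S × v ∈ T × u ~ v)
    arc? S T (u , v) = (u ∈? S) ×-dec (v ∈? T) ×-dec (u ~? v)

  -- A neighbour `v ∈ T` of `u ∈ S` puts the arc `(u , v)` into the row of `u`.
  count-withNeighbourIn≤e : ∀ S T → count (∈-withNeighbourIn? S T) (allFin n) ℕ.≤ e G S T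
  count-withNeighbourIn≤e S T =
    count≤count-cartesianProduct (arc? S T) (∈-withNeighbourIn? S T) (allFin n)
      (λ u (u∈S , v , v∈T , u~v) →
        ∈-length (∈-filter⁺ (λ v → arc? S T (u , v)) (∈-allFin v) (u∈S , v∈T , u~v)))
      (allFin n)

  -- The second components in the row of `u` are neighbours of `u`, so the row has at most
  -- `degree u` entries. It is empty if `u` lies outside `S` or has no neighbour in `T`.
  e≤count-withNeighbourIn* : ∀ {d} → Regular G d → ∀ S T →
    e G S T ℕ.≤ count (∈-withNeighbourIn? S T) (allFin n) ℕ.* d
  e≤count-withNeighbourIn* {d} reg S T =
    count-cartesianProduct≤count* (arc? S T) (∈-withNeighbourIn? S T) (allFin n) d
      (λ u _ → subst (_ ℕ.≤_) (reg u)
        (count-mono (λ v → arc? S T (u , v)) (u ~?_) (proj₂ ∘ proj₂) (allFin n)))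
      (λ u ¬Pu → cong length (filter-none (λ v → arc? S T (u , v))
        (All.universal (λ v (u∈S , v∈T , u~v) → ¬Pu (u∈S , v , v∈T , u~v)) (allFin n))))
      (allFin n)

  length-∂-out : ∀ S → length (∂-out G S) ≡ count (∈-withNeighbourIn? (∁ S) S) (allFin n)
  length-∂-out S = cong length (filter-≐ _ (∈-withNeighbourIn? (∁ S) S)
    ( (λ (v∉S , nb) → x∉p⇒x∈∁p v∉S , nb)
    , (λ (v∈∁S , nb) → x∈∁p⇒x∉p v∈∁S , nb))
    (allFin n))

  -- An edge of ∂ S listed as (u , v) with u < v gives the arc (u , v) from ∁ S
  -- to S if v ∈ S, and the arc (v , u) if u ∈ S.
  length-∂ : ∀ S → length (∂ G S) ≡ e G (∁ S) S
  length-∂ S = begin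
    length (∂ G S)                            ≡⟨ count-⊎ first? second? (λ _ (u∈S , _) (u∉S , _) → u∉S u∈S) (edges G) ⟩
    length firsts + length seconds            ≡⟨ cong (_+ length seconds) (length-map swap firsts) ⟨
    length (map swap firsts) + length seconds ≡⟨ length-++ (map swap firsts) ⟨
    -- Two duplicate-free lists with the same members are permutations of each other.
    length (map swap firsts ++ seconds)       ≡⟨ ↭-length (∼bag⇒↭ (unique∧set⇒bag unique-oriented unique-arcs (mk⇔ to from))) ⟩
    e G (∁ S) S                               ∎
    where
    open ≡-Reasoning

    edge? : Decidable (λ ((u , v) : Fin n × Fin n) → u Fin.< v × u ~ v)
    edge? (u , v) = (u <? v) ×-dec (u ~? v)

    first? : Decidable (λ ((u , v) : Fin n × Fin n) → u ∈ S × v ∉ S)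
    first? (u , v) = (u ∈? S) ×-dec ¬? (v ∈? S)

    second? : Decidable (λ ((u , v) : Fin n × Fin n) → u ∉ S × v ∈ S)
    second? (u , v) = ¬? (u ∈? S) ×-dec (v ∈? S)

    firsts seconds arcs : List (Fin n × Fin n)
    firsts  = filter first? (edges G)
    seconds = filter second? (edges G)
    arcs    = filter (arc? (∁ S) S) (vertexPairs G)

    ∈-pairs : ∀ x → x ∈ₗ vertexPairs G
    ∈-pairs (u , v) = ∈-cartesianProduct⁺ (∈-allFin u) (∈-allFin v)

    unique-pairs : Unique (vertexPairs G)
    unique-pairs = Unique.cartesianProduct⁺ (Unique.allFin⁺ n) (Unique.allFin⁺ n)

    unique-edges : Unique (edges G)
    unique-edges = Unique.filter⁺ edge? unique-pairs

    unique-arcs : Unique arcs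
    unique-arcs = Unique.filter⁺ (arc? (∁ S) S) unique-pairs

    ∈-edges⁻ : ∀ {u v} → (u , v) ∈ₗ edges G → u Fin.< v × u ~ v
    ∈-edges⁻ = proj₂ ∘ ∈-filter⁻ edge? {xs = vertexPairs G}

    unique-oriented : Unique (map swap firsts ++ seconds)
    unique-oriented = Unique.++⁺
      (Unique.map⁺ (cong swap) (Unique.filter⁺ first? unique-edges))
      (Unique.filter⁺ second? unique-edges)
      λ (∈swapped , ∈seconds) → disjoint ∈swapped ∈seconds
      where
      disjoint : ∀ {x} → x ∈ₗ map swap firsts → ¬ x ∈ₗ seconds
      -- A common pair and its reverse would both be in `edges`, so each endpoint would be smaller
      -- than the other.
      disjoint ∈swapped ∈seconds with _ , ∈firsts , refl ← ∈-map⁻ swap ∈swapped =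
        <-asym (proj₁ (∈-edges⁻ (proj₁ (∈-filter⁻ first? ∈firsts))))
               (proj₁ (∈-edges⁻ (proj₁ (∈-filter⁻ second? ∈seconds))))

    to : ∀ {x} → x ∈ₗ map swap firsts ++ seconds → x ∈ₗ arcs
    to x∈ with ∈-++⁻ (map swap firsts) x∈
    ... | inj₁ ∈swapped
        with _ , ∈firsts , refl ← ∈-map⁻ swap ∈swapped
        with ∈edges , u∈S , v∉S ← ∈-filter⁻ first? ∈firsts
      = ∈-filter⁺ (arc? (∁ S) S) (∈-pairs _) (x∉p⇒x∈∁p v∉S , u∈S , ~-sym (proj₂ (∈-edges⁻ ∈edges)))
    ... | inj₂ ∈seconds
        with ∈edges , u∉S , v∈S ← ∈-filter⁻ second? ∈seconds
      = ∈-filter⁺ (arc? (∁ S) S) (∈-pairs _) (x∉p⇒x∈∁p u∉S , v∈S , proj₂ (∈-edges⁻ ∈edges))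

    from : ∀ {x} → x ∈ₗ arcs → x ∈ₗ map swap firsts ++ seconds
    from {u , v} x∈
      with _ , u∈∁S , v∈S , u~v ← ∈-filter⁻ (arc? (∁ S) S) {xs = vertexPairs G} x∈ | <-cmp u v
    ... | tri< u<v _ _ = ∈-++⁺ʳ (map swap firsts)
            (∈-filter⁺ second? (∈-filter⁺ edge? (∈-pairs _) (u<v , u~v)) (x∈∁p⇒x∉p u∈∁S , v∈S))
    ... | tri≈ _ u≡v _ = contradiction u~v (~-irrefl u≡v)
    ... | tri> _ _ v<u = ∈-++⁺ˡ (∈-map⁺ swap
            (∈-filter⁺ first? (∈-filter⁺ edge? (∈-pairs _) (v<u , ~-sym u~v)) (v∈S , x∈∁p⇒x∉p u∈∁S)))

  length-∂-out≤length-∂ : ∀ S → length (∂-out G S) ℕ.≤ length (∂ G S)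
  length-∂-out≤length-∂ S rewrite length-∂-out S | length-∂ S = count-withNeighbourIn≤e (∁ S) S

  length-∂≤length-∂-out* : ∀ {d} → Regular G d → ∀ S → length (∂ G S) ℕ.≤ length (∂-out G S) ℕ.* d
  length-∂≤length-∂-out* reg S rewrite length-∂-out S | length-∂ S = e≤count-withNeighbourIn* reg (∁ S) S

-- Inequalities between fractions.

toℚᵘ-/ : ∀ i m .{{_ : NonZero m}} → toℚᵘ (i / m) ℚᵘ.≃ i ℚᵘ./ m
-- The denominator is matched because `fromℚᵘ (mkℚᵘ i m)` unfolds to `i / suc m`.
toℚᵘ-/ i (suc m) = toℚᵘ-fromℚᵘ (ℚᵘ.mkℚᵘ i m)

-- Cross-multiplication is the definition of the order on unnormalised rationals; passing through
-- them avoids any reasoning about reduction to lowest terms.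
/-mono-≤ : ∀ k l {m o} .{{_ : NonZero m}} .{{_ : NonZero o}} →
           k ℕ.* o ℕ.≤ l ℕ.* m → + k / m ≤ + l / o
/-mono-≤ k l {m@(suc _)} {o@(suc _)} ko≤lm = toℚᵘ-cancel-≤ (begin
  toℚᵘ (+ k / m)  ≃⟨ toℚᵘ-/ (+ k) m ⟩
  + k ℚᵘ./ m      ≤⟨ ℚᵘ.*≤* (subst₂ ℤ._≤_ (ℤ.pos-* k o) (ℤ.pos-* l m) (ℤ.+≤+ ko≤lm)) ⟩
  + l ℚᵘ./ o      ≃⟨ toℚᵘ-/ (+ l) o ⟨
  toℚᵘ (+ l / o)  ∎)
  where open ℚᵘ.≤-Reasoning

-- Before reduction the product on the left already has denominator `d ℕ.* m`, so only the
-- numerators remain to be compared.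
1/*/≤/ : ∀ {k l} d m .{{_ : NonZero d}} .{{_ : NonZero m}} .{{_ : NonZero (d ℕ.* m)}} →
         k ℕ.≤ l → (+ 1 / d) * (+ k / m) ≤ + l / (d ℕ.* m)
1/*/≤/ {k} {l} d@(suc _) m@(suc _) k≤l = toℚᵘ-cancel-≤ (begin
  toℚᵘ ((+ 1 / d) * (+ k / m))           ≃⟨ toℚᵘ-homo-* (+ 1 / d) (+ k / m) ⟩
  toℚᵘ (+ 1 / d) ℚᵘ.* toℚᵘ (+ k / m)     ≃⟨ ℚᵘ.*-cong (toℚᵘ-/ (+ 1) d) (toℚᵘ-/ (+ k) m) ⟩
  (+ 1 ℤ.* + k) ℚᵘ./ (d ℕ.* m)           ≡⟨ cong (ℚᵘ._/ (d ℕ.* m)) (ℤ.*-identityˡ (+ k)) ⟩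
  + k ℚᵘ./ (d ℕ.* m)                     ≃⟨ toℚᵘ-/ (+ k) (d ℕ.* m) ⟨
  toℚᵘ (+ k / (d ℕ.* m))                 ≤⟨ toℚᵘ-mono-≤ (/-mono-≤ k l (ℕ.*-monoˡ-≤ (d ℕ.* m) k≤l)) ⟩
  toℚᵘ (+ l / (d ℕ.* m))                 ∎)
  where open ℚᵘ.≤-Reasoning

-- Comparing minima over disjoint pairs.

module _ {n : ℕ} .{{_ : NonZero n}} where

  minimum≤ : (f : DisjointPair n → ℚ) → minimum f ≤ f (wholePair n) × All (λ x → minimum f ≤ f x) (disjointPairs n)
  minimum≤ f = min≤⊤ _ (map f (disjointPairs n)) , All.map⁻ (min≤xs (f (wholePair n)) (map f (disjointPairs n)))

  ≤minimum : ∀ {v} (f : DisjointPair n → ℚ) → v ≤ f (wholePair n) → All (λ x → v ≤ f x) (disjointPairs n) → v ≤ minimum f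
  ≤minimum f v≤ v≤s = v≤min⁺ v≤ (All.map⁺ v≤s)

  -- Each value `g x` is at least `h (f x)`, which is at least `h (minimum f)` by monotonicity. The
  -- map `h` lets one argument serve both bounds: it is the identity for one and multiplication by
  -- `+ 1 / d` for the other.
  minimum-mono : (h : ℚ → ℚ) → (∀ {x y} → x ≤ y → h x ≤ h y) →
                 ∀ {f g : DisjointPair n → ℚ} → (∀ x → h (f x) ≤ g x) → h (minimum f) ≤ minimum g
  minimum-mono h h-mono {f} {g} hf≤g = ≤minimum g
    (≤-trans (h-mono (proj₁ (minimum≤ f))) (hf≤g (wholePair n)))
    (All.map (λ {x} le → ≤-trans (h-mono le) (hf≤g x)) (proj₂ (minimum≤ f)))

-- The two inequalities for a single pair.

module _ {n : ℕ} (G : Graph n) {d : ℕ} .{{d≢0 : NonZero d}} where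

  -- Each of the three terms in the numerator of `b` is at most `d` times its counterpart in
  -- `b-out`, and this `d` cancels against the one in the denominator of `b`.
  b≤b-out : Regular G d → ∀ x → b G d x ≤ b-out G x
  b≤b-out reg (disjointPair L R _ ne) =
    /-mono-≤ (e G L L + e G R R + length (∂ G S)) (I G L + I G R + length (∂-out G S))
      {{ℕ.m*n≢0 d ∣ S ∣ {{d≢0}} {{nonempty⇒∣p∣≢0 ne}}}} {{nonempty⇒∣p∣≢0 ne}}
      (begin
      (e G L L + e G R R + length (∂ G S)) ℕ.* ∣ S ∣
        ≤⟨ ℕ.*-monoˡ-≤ ∣ S ∣ (ℕ.+-mono-≤ (ℕ.+-mono-≤ (e≤count-withNeighbourIn* G reg L L)
             (e≤count-withNeighbourIn* G reg R R)) (length-∂≤length-∂-out* G reg S)) ⟩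
      (I G L ℕ.* d + I G R ℕ.* d + length (∂-out G S) ℕ.* d) ℕ.* ∣ S ∣
        ≡⟨ cong (λ k → (k + length (∂-out G S) ℕ.* d) ℕ.* ∣ S ∣) (ℕ.*-distribʳ-+ d (I G L) (I G R)) ⟨
      ((I G L + I G R) ℕ.* d + length (∂-out G S) ℕ.* d) ℕ.* ∣ S ∣
        ≡⟨ cong (ℕ._* ∣ S ∣) (ℕ.*-distribʳ-+ d (I G L + I G R) (length (∂-out G S))) ⟨
      (I G L + I G R + length (∂-out G S)) ℕ.* d ℕ.* ∣ S ∣
        ≡⟨ ℕ.*-assoc (I G L + I G R + length (∂-out G S)) d ∣ S ∣ ⟩
      (I G L + I G R + length (∂-out G S)) ℕ.* (d ℕ.* ∣ S ∣) ∎)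
    where
    open ℕ.≤-Reasoning
    S = L ∪ R

  -- The numerator of `b-out` is termwise at most that of `b`; the factor `+ 1 / d` makes the
  -- denominators agree.
  1/d*b-out≤b : ∀ x → (+ 1 / d) * b-out G x ≤ b G d x
  1/d*b-out≤b (disjointPair L R _ ne) =
    1/*/≤/ d ∣ L ∪ R ∣ {{d≢0}} {{nonempty⇒∣p∣≢0 ne}} {{ℕ.m*n≢0 d ∣ L ∪ R ∣ {{d≢0}} {{nonempty⇒∣p∣≢0 ne}}}}
      (ℕ.+-mono-≤ (ℕ.+-mono-≤ (count-withNeighbourIn≤e G L L) (count-withNeighbourIn≤e G R R))
        (length-∂-out≤length-∂ G (L ∪ R)))

theorem2 : ∀ (n d : ℕ) (G : Graph n) → Connected G → (¬bip : ¬ Bipartite G) → (reg : Regular G d) →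
    let instance
          n≢0 : NonZero n
          n≢0 = nonBipartite⇒n≢0 {G = G} ¬bip
          d≢0 : NonZero d
          d≢0 = nonBipartite⇒d≢0 {G = G} ¬bip reg
    in (β-out G ≥ β G d) × (β G d ≥ (+ 1 / d) * β-out G)
theorem2 n d G _ ¬bip reg =
    minimum-mono (λ x → x) (λ x≤y → x≤y) (b≤b-out G reg)
  -- Multiplication by `+ 1 / d` is monotone because this number, which unfolds to `normalize 1 d`,
  -- is nonnegative.
  , minimum-mono ((+ 1 / d) *_) (*-monoˡ-≤-nonNeg (+ 1 / d) {{normalize-nonNeg 1 d}}) (1/d*b-out≤b G)
  where
  instance
    n≢0 : NonZero n
    n≢0 = nonBipartite⇒n≢0 {G = G} ¬bip
    d≢0 : NonZero d
    d≢0 = nonBipartite⇒d≢0 {G = G} ¬bip reg
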